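{- Let $G$ be a finite graph (without loops or multiple edges) with no isolated vertices, and let $n$ be its number of vertices. If $n$ is even, then there exists no nontrivial circuit injection $f: G_M\to B$ with $B$ a binary matroid if and only if $G$ is Hamiltonian. If $n$ is odd, then there exists no nontrivial circuit injection $f: G_M\to B$ with $B$ a binary matroid if and only if $G$ is almost Hamiltonian.
   Context: $G_M$ denotes the cycle matroid of $G$: its cells are the edges of $G$ and its circuits are the circuits (cycles, as edge sets) of $G$. A matroid $\{S,\mathscr{C}\}$ is given by its cell set $S$ and circuit family $\mathscr{C}$. It is binary if for all $A,B\in\mathscr{C}$, $A\oplus B=(A\cup B)\setminus (A\cap B)$ is a union of pairwise disjoint circuits. A circuit injection $f: \{S,\mathscr{C}\}\to\{S',\mathscr{C}'\}$ is a bijection $f:S\to S'$ with $f(A)\in\mathscr{C}'$ for every $A\in\mathscr{C}$; it is nontrivial if some $B\in\mathscr{C}'$ is not of the form $f(A)$ with $A\in\mathscr{C}$. $G$ is Hamiltonian if it has a circuit through all its vertices. A graph of order $n$ is almost Hamiltonian if every set of $n-1$ of its vertices is contained in (the vertex set of) some circuit. -}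

module Defs where

open import Data.Nat using (ℕ; zero; suc; _+_; _≤_; _∸_)
open import Data.Nat.DivMod using (_%_; m%n<n)
open import Data.Fin using (Fin; toℕ; fromℕ<)
open import Data.Fin.Subset using (Subset; _∈_; _⊆_; _∪_; _∩_; _─_; _-_; ⊥; Empty; Nonempty; ∣_∣)
open import Data.Vec using (tabulate; lookup)
open import Data.List using (List; foldr)
open import Data.List.Relation.Unary.All using (All)
open import Data.List.Relation.Unary.AllPairs using (AllPairs)
open import Data.Product using (Σ; ∃; ∃-syntax; _×_)
open import Data.Sum using (_⊎_)
open import Relation.Binary.PropositionalEquality using (_≡_; _≢_)
open import Function.Bundles using (_↔_; Inverse; _⇔_)
open import Function.Definitions using (Injective)
open import Relation.Nullary using (¬_)

Joins : ∀ {n m} → (Fin m → Fin n) → (Fin m → Fin n) → Fin m → Fin n → Fin n → Set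
Joins src tgt e u v = (src e ≡ u × tgt e ≡ v) ⊎ (src e ≡ v × tgt e ≡ u)

record Graph (n m : ℕ) : Set where
  field
    src tgt   : Fin m → Fin n
    loopless  : ∀ e → src e ≢ tgt e
    no-multi  : ∀ e e' → Joins src tgt e' (src e) (tgt e) → e ≡ e'

module _ {n m : ℕ} (G : Graph n m) where
  open Graph G

  Incident : Fin m → Fin n → Set
  Incident e v = src e ≡ v ⊎ tgt e ≡ v

  NoIsolatedVertices : Set
  NoIsolatedVertices = ∀ v → ∃[ e ] Incident e v

  next : ∀ {k} → Fin (suc k) → Fin (suc k)
  next {k} i = fromℕ< (m%n<n (suc (toℕ i)) (suc k))

  record Cycle : Set where
    field
      k     : ℕ
      vs    : Fin (3 + k) → Fin n
      vs-inj : Injective _≡_ _≡_ vs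
      es    : Fin (3 + k) → Fin m
      es-joins : ∀ i → Joins src tgt (es i) (vs i) (vs (next i))

  OnCycle : Cycle → Fin n → Set
  OnCycle c v = ∃[ i ] Cycle.vs c i ≡ v

  EdgeSetOf : Cycle → Subset m → Set
  EdgeSetOf c A = ∀ e → (e ∈ A) ⇔ (∃[ i ] Cycle.es c i ≡ e)

  -- circuits of the cycle matroid G_M (cells = edges of G)
  GraphCircuit : Subset m → Set
  GraphCircuit A = ∃[ c ] EdgeSetOf c A

  Hamiltonian : Set
  Hamiltonian = ∃[ c ] (∀ v → OnCycle c v)

  AlmostHamiltonian : Set
  AlmostHamiltonian =
    ∀ (X : Subset n) → ∣ X ∣ ≡ n ∸ 1 → ∃[ c ] (∀ v → v ∈ X → OnCycle c v)

-- Matroids given by cell set Fin k and a circuit family (a predicate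
-- on subsets), with the standard circuit axioms.

Disjoint : ∀ {k} → Subset k → Subset k → Set
Disjoint A B = Empty (A ∩ B)

record IsMatroid {k : ℕ} (𝒞 : Subset k → Set) : Set where
  field
    nonempty    : ∀ A → 𝒞 A → Nonempty A
    incomparable : ∀ A B → 𝒞 A → 𝒞 B → A ⊆ B → A ≡ B
    elimination : ∀ A B e → 𝒞 A → 𝒞 B → A ≢ B → e ∈ (A ∩ B) →
                  ∃[ C ] (𝒞 C × C ⊆ ((A ∪ B) - e))

_⊕_ : ∀ {k} → Subset k → Subset k → Subset k
A ⊕ B = (A ∪ B) ─ (A ∩ B)

IsDisjointUnionOfCircuits : ∀ {k} → (Subset k → Set) → Subset k → Set
IsDisjointUnionOfCircuits 𝒞 X =
  ∃[ Cs ] (All 𝒞 Cs × AllPairs Disjoint Cs × foldr _∪_ ⊥ Cs ≡ X)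

IsBinary : ∀ {k} → (Subset k → Set) → Set
IsBinary 𝒞 = ∀ A B → 𝒞 A → 𝒞 B → IsDisjointUnionOfCircuits 𝒞 (A ⊕ B)

image : ∀ {m k} → Fin m ↔ Fin k → Subset m → Subset k
image f A = tabulate (λ y → lookup A (Inverse.from f y))

IsCircuitInjection : ∀ {m k} → (Subset m → Set) → (Subset k → Set) → Fin m ↔ Fin k → Set
IsCircuitInjection 𝒞 𝒞' f = ∀ A → 𝒞 A → 𝒞' (image f A)

IsNontrivial : ∀ {m k} → (Subset m → Set) → (Subset k → Set) → Fin m ↔ Fin k → Set
IsNontrivial 𝒞 𝒞' f = ∃[ B ] (𝒞' B × (∀ A → 𝒞 A → image f A ≢ B))

HasNontrivialBinaryCircuitInjection : ∀ {n m} → Graph n m → Set₁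
HasNontrivialBinaryCircuitInjection {n} {m} G =
  Σ ℕ λ k → Σ (Subset k → Set) λ 𝒞' → Σ (Fin m ↔ Fin k) λ f →
    IsMatroid 𝒞' × IsBinary 𝒞' ×
    IsCircuitInjection (GraphCircuit G) 𝒞' f × IsNontrivial (GraphCircuit G) 𝒞' f

{-# OPTIONS --safe #-}
-- Let ∂ send an edge set to the set of vertices at which its degree is odd; the cycle space is the kernel
-- of ∂. If ∂X is nonempty and no cycle passes through all of ∂X, then the minimal nonempty edge sets A with
-- ∂A = ∅ or ∂A = ∂X form a binary matroid: a member of the coset ∂A = ∂X inside a cycle C would force ∂X
-- into the vertices of C, so all cycles of G remain circuits, while some circuit lies in the coset.
-- Conversely, let f be a circuit injection with a new circuit B = f(X). Then X contains no cycle, so ∂X ≠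
-- ∅. If ∂X lies on a cycle C, then some Y ⊊ C has ∂Y = ∂X; hence X + Y is a sum of cycles, f(Y) a sum of
-- circuits, and f(Y) contains a circuit properly inside the circuit f(C), a contradiction. So no nontrivial
-- injection exists exactly when every nonempty boundary lies on a cycle. In that case G is connected, the
-- boundaries are the vertex sets of even size, and parity of n separates the two statements.
module Submission where

open import Defs
open import Algebra.Bundles using (CommutativeRing)
import Algebra.Properties.Semiring.Sum as Sum
import Data.Bool as Bool
open import Data.Bool using (Bool; true; false; _∧_; _∨_; _xor_; not)
open import Data.Bool.Properties using (xor-assoc; xor-comm; xor-same; xor-identityʳ; xor-∧-commutativeRing; ∧-distribˡ-xor; ∧-distribʳ-xor; ∧-zeroʳ; ¬-not; not-involutive; ∧-identityʳ)
open import Data.Empty using () renaming (⊥ to False)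
open import Data.Fin using (Fin; zero; suc; toℕ; fromℕ; inject₁; _≟_)
open import Data.Fin.Induction using (<-weakInduction; >-weakInduction)
open import Data.Fin.Permutation using (permutation)
open import Data.Fin.Properties using (any?; all?; toℕ-injective; toℕ-fromℕ<; toℕ-fromℕ; toℕ-inject₁; toℕ<n; suc-injective; injective⇒≤)
open import Data.Fin.Relation.Unary.Top using (view; ‵fromℕ; ‵inject₁)
open import Data.Fin.Subset using (_-_; ⋃; Subset; _∈_; _⊆_; _∪_; _∩_; ⊥; Nonempty; ∣_∣; ⊤; ⁅_⁆; _⊂_; ∁)
open import Data.Fin.Subset.Properties using (nonempty?; Empty-unique; ∣⊥∣≡0; p⊂q⇒∣p∣<∣q∣; p⊆q⇒∣p∣≤∣q∣; x∈p∩q⁺; x∈p∩q⁻; ⊆-trans; p⊆p∪q; q⊆p∪q; ∉⊥; x∈p∧x≢y⇒x∈p-y; p─q⊆p; ∣⁅x⁆∣≡1; x∈⁅y⁆⇒x≡y; x∈p∪q⁻; ⊆-antisym; x∈⁅x⁆; ⊆-refl; ∈⊤; x∉p⇒x∈∁p; ∣∁p∣≡n∸∣p∣; _∈?_; _⊆?_; anySubset?)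
open import Data.List using (List; []; _∷_; foldr; map; _++_)
open import Data.List.Properties using (map-++)
open import Data.List.Relation.Binary.Permutation.Propositional as Perm using (_↭_; ↭-refl; ↭-prep; ↭-swap; ↭-trans)
open import Data.List.Relation.Binary.Permutation.Propositional.Properties using (All-resp-↭) renaming (map⁺ to ↭-map⁺)
open import Data.List.Relation.Unary.All as All using (All; []; _∷_)
open import Data.List.Relation.Unary.All.Properties using (++⁺)
open import Data.List.Relation.Unary.AllPairs using (AllPairs; []; _∷_)
open import Data.Nat using (ℕ; zero; suc; _+_; _≤_; _<_; z≤n; s≤s; s≤s⁻¹; _*_; _∸_)
open import Data.Nat.DivMod using (_%_; m<n⇒m%n≡m; n%n≡0)
open import Data.Nat.Divisibility using (_∣_; divides; ∣-refl; ∣m∣n⇒∣m+n; _∣0)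
open import Data.Nat.Induction using (<-wellFounded)
open import Data.Nat.ListAction using () renaming (sum to total)
open import Data.Nat.ListAction.Properties using (sum-++; sum-↭)
open import Data.Nat.Properties using (+-suc; +-identityʳ; m<m+n; +-monoˡ-<; <-≤-trans; ≤-trans; +-assoc; m≤m+n; module ≤-Reasoning; ≤⇒≯; anyUpTo?; m≤n+m; n<1+n; m≤n⇒m≤1+n; <⇒≢)
open import Data.Nat.Tactic.RingSolver using (solve-∀)
open import Data.Product using (∃-syntax; _×_; _,_; proj₁; proj₂)
open import Data.Sum using (_⊎_; inj₁; inj₂; swap)
open import Data.Vec using ([]; _∷_; lookup; tabulate)
open import Data.Vec.Properties using ([]=⇒lookup; lookup⇒[]=; tabulate∘lookup; tabulate-cong; lookup-zipWith; lookup-replicate; lookup∘tabulate; ≡-dec)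
open import Function using (_∘_; mk⇔)
open import Function.Bundles using (_↔_; _⇔_; Inverse; Equivalence)
open import Function.Properties.Inverse using (↔-refl)
open import Induction.WellFounded using (Acc; acc)
open import Relation.Binary.PropositionalEquality using (_≡_; _≢_; refl; sym; trans; cong; cong₂; subst; module ≡-Reasoning; subst₂)
open import Relation.Nullary using (¬_; yes; no; contradiction)
open import Relation.Nullary.Decidable using (Dec; does; dec-true; dec-false; _×-dec_; ¬?; map′; _→-dec_; _⊎-dec_; decidable-stable)

-- Subsets under symmetric difference

private variable
  k m n : ℕ
  A B C : Subset k
  e : Fin k

∈⁺ : lookup A e ≡ true → e ∈ A
∈⁺ {A = A} {e} = lookup⇒[]= e A

subset-ext : (∀ e → lookup A e ≡ lookup B e) → A ≡ B
subset-ext {A = A} {B} eq =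
  trans (sym (tabulate∘lookup A)) (trans (tabulate-cong eq) (tabulate∘lookup B))

lookup-⊕ : (A B : Subset k) (e : Fin k) → lookup (A ⊕ B) e ≡ lookup A e xor lookup B e
lookup-⊕ (false ∷ _) (false ∷ _) zero = refl
lookup-⊕ (false ∷ _) (true ∷ _) zero = refl
lookup-⊕ (true ∷ _) (false ∷ _) zero = refl
lookup-⊕ (true ∷ _) (true ∷ _) zero = refl
lookup-⊕ (_ ∷ A) (_ ∷ B) (suc e) = lookup-⊕ A B e

⊕-comm : (A B : Subset k) → A ⊕ B ≡ B ⊕ A
⊕-comm A B = subset-ext λ e →
  trans (lookup-⊕ A B e) (trans (xor-comm (lookup A e) (lookup B e)) (sym (lookup-⊕ B A e)))

⊕-assoc : (A B C : Subset k) → (A ⊕ B) ⊕ C ≡ A ⊕ (B ⊕ C)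
⊕-assoc A B C = subset-ext λ e → begin
  lookup ((A ⊕ B) ⊕ C) e                        ≡⟨ lookup-⊕ (A ⊕ B) C e ⟩
  lookup (A ⊕ B) e xor lookup C e               ≡⟨ cong (_xor lookup C e) (lookup-⊕ A B e) ⟩
  (lookup A e xor lookup B e) xor lookup C e    ≡⟨ xor-assoc (lookup A e) _ _ ⟩
  lookup A e xor (lookup B e xor lookup C e)    ≡⟨ cong (lookup A e xor_) (lookup-⊕ B C e) ⟨
  lookup A e xor lookup (B ⊕ C) e               ≡⟨ lookup-⊕ A (B ⊕ C) e ⟨
  lookup (A ⊕ (B ⊕ C)) e                        ∎
  where open ≡-Reasoning

⊕-self : (A : Subset k) → A ⊕ A ≡ ⊥
⊕-self A = subset-ext λ e →
  trans (lookup-⊕ A A e) (trans (xor-same (lookup A e)) (sym (lookup-replicate e false)))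

⊕-identityˡ : (A : Subset k) → ⊥ ⊕ A ≡ A
⊕-identityˡ A = subset-ext λ e →
  trans (lookup-⊕ ⊥ A e) (cong (_xor lookup A e) (lookup-replicate e false))

⊕-identityʳ : (A : Subset k) → A ⊕ ⊥ ≡ A
⊕-identityʳ A = trans (⊕-comm A ⊥) (⊕-identityˡ A)

⊕-cancelˡ : (A B : Subset k) → A ⊕ (A ⊕ B) ≡ B
⊕-cancelˡ A B =
  trans (sym (⊕-assoc A A B)) (trans (cong (_⊕ B) (⊕-self A)) (⊕-identityˡ B))

≢⇒⊕-nonempty : (A B : Subset k) → A ≢ B → Nonempty (A ⊕ B)
≢⇒⊕-nonempty A B A≢B with nonempty? (A ⊕ B)
... | yes ne = ne
... | no ¬ne = contradiction
  (trans (sym (⊕-identityʳ A)) (trans (cong (A ⊕_) (sym (Empty-unique ¬ne))) (⊕-cancelˡ A B))) A≢B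

∈-⊕ : (A B : Subset k) → e ∈ (A ⊕ B) → e ∈ A → ¬ e ∈ B
∈-⊕ {e = e} A B p a b
  with () ← trans (sym ([]=⇒lookup p)) (trans (lookup-⊕ A B e) (cong₂ _xor_ ([]=⇒lookup a) ([]=⇒lookup b)))

⊕-⊆-minus : (A B : Subset k) → e ∈ (A ∩ B) → (A ⊕ B) ⊆ ((A ∪ B) - e)
⊕-⊆-minus A B e∈ x∈ = x∈p∧x≢y⇒x∈p-y (p─q⊆p (A ∪ B) (A ∩ B) x∈)
  λ { refl → ∈-⊕ A B x∈ (proj₁ (x∈p∩q⁻ A B e∈)) (proj₂ (x∈p∩q⁻ A B e∈)) }

-- Common elements count twice on the right, hence the doubled term. The additive form avoids
-- truncated subtraction; it yields equality for disjoint sets and a strict drop for meeting ones.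
∣⊕∣ : (A B : Subset k) → ∣ A ⊕ B ∣ + (∣ A ∩ B ∣ + ∣ A ∩ B ∣) ≡ ∣ A ∣ + ∣ B ∣
∣⊕∣ [] [] = refl
∣⊕∣ (false ∷ A) (false ∷ B) = ∣⊕∣ A B
∣⊕∣ (false ∷ A) (true ∷ B) = trans (cong suc (∣⊕∣ A B)) (sym (+-suc ∣ A ∣ ∣ B ∣))
∣⊕∣ (true ∷ A) (false ∷ B) = cong suc (∣⊕∣ A B)
∣⊕∣ (true ∷ A) (true ∷ B) =
  trans (shift ∣ A ⊕ B ∣ ∣ A ∩ B ∣) (cong suc (trans (cong suc (∣⊕∣ A B)) (sym (+-suc ∣ A ∣ ∣ B ∣))))
  where
  shift : ∀ x y → x + (suc y + suc y) ≡ suc (suc (x + (y + y)))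
  shift = solve-∀

disjoint⇒∪≡⊕ : (A B : Subset k) → Disjoint A B → A ∪ B ≡ A ⊕ B
disjoint⇒∪≡⊕ A B A#B = subset-ext λ e → trans (lookup-zipWith _∨_ e A B)
  (trans (bits (lookup A e) (lookup B e) (λ a b → A#B (e , x∈p∩q⁺ (∈⁺ a , ∈⁺ b)))) (sym (lookup-⊕ A B e)))
  where
  bits : ∀ a b → (a ≡ true → b ≡ true → False) → a ∨ b ≡ a xor b
  bits false b _ = refl
  bits true false _ = refl
  bits true true ab = contradiction (ab refl refl) λ ()

disjoint⇒∣⊕∣ : (A B : Subset k) → Disjoint A B → ∣ A ⊕ B ∣ ≡ ∣ A ∣ + ∣ B ∣
disjoint⇒∣⊕∣ {k} A B A#B = begin
  ∣ A ⊕ B ∣                             ≡⟨ +-identityʳ _ ⟨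
  ∣ A ⊕ B ∣ + (0 + 0)                   ≡⟨ cong (λ z → ∣ A ⊕ B ∣ + (z + z)) 0≡ ⟩
  ∣ A ⊕ B ∣ + (∣ A ∩ B ∣ + ∣ A ∩ B ∣)   ≡⟨ ∣⊕∣ A B ⟩
  ∣ A ∣ + ∣ B ∣                         ∎
  where
  open ≡-Reasoning
  0≡ : 0 ≡ ∣ A ∩ B ∣
  0≡ = sym (trans (cong ∣_∣ (Empty-unique A#B)) (∣⊥∣≡0 k))

meeting⇒∣⊕∣< : (A B : Subset k) → Nonempty (A ∩ B) → ∣ A ⊕ B ∣ < ∣ A ∣ + ∣ B ∣
meeting⇒∣⊕∣< {k} A B (e , e∈) = subst (∣ A ⊕ B ∣ <_) (∣⊕∣ A B)
  (m<m+n _ (≤-trans (subst (_≤ ∣ A ∩ B ∣) (∣⁅x⁆∣≡1 e)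
    (p⊆q⇒∣p∣≤∣q∣ λ {x} x∈ → subst (_∈ (A ∩ B)) (sym (x∈⁅y⁆⇒x≡y e x∈)) e∈))
    (m≤m+n _ _)))

module _ {X C : Subset k} (C⊆X : C ⊆ X) where

  ⊆⇒⊕⊆ : (X ⊕ C) ⊆ X
  ⊆⇒⊕⊆ {e} p with lookup X e in x | lookup C e in c
  ... | true | _ = ∈⁺ x
  ... | false | true = C⊆X (∈⁺ c)
  ... | false | false with () ← trans (sym ([]=⇒lookup p)) (trans (lookup-⊕ X C e) (cong₂ _xor_ x c))

  ⊆⇒disjoint-⊕ : Disjoint C (X ⊕ C)
  ⊆⇒disjoint-⊕ (e , p) with x∈p∩q⁻ C (X ⊕ C) p
  ... | c , q = ∈-⊕ X C q (C⊆X c) c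

  ⊆⇒∪-⊕ : C ∪ (X ⊕ C) ≡ X
  ⊆⇒∪-⊕ = trans (disjoint⇒∪≡⊕ C (X ⊕ C) ⊆⇒disjoint-⊕) (trans (cong (C ⊕_) (⊕-comm X C)) (⊕-cancelˡ C X))

  ⊆⇒∣⊕∣< : Nonempty C → ∣ X ⊕ C ∣ < ∣ X ∣
  ⊆⇒∣⊕∣< (e , c) = p⊂q⇒∣p∣<∣q∣ (⊆⇒⊕⊆ , e , C⊆X c , λ q → ∈-⊕ X C q (C⊆X c) c)

-- Lists of subsets and disjoint decompositions

⨁ : List (Subset k) → Subset k
⨁ = foldr _⊕_ ⊥

members-⊆-⋃ : (Cs : List (Subset k)) → All (_⊆ ⋃ Cs) Cs
members-⊆-⋃ [] = []
members-⊆-⋃ (C ∷ Cs) =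
  p⊆p∪q (⋃ Cs) ∷ All.map (λ D⊆ {_} x∈ → q⊆p∪q C (⋃ Cs) (D⊆ x∈)) (members-⊆-⋃ Cs)

disjoint-⋃ : {Cs : List (Subset k)} → All (Disjoint C) Cs → Disjoint C (⋃ Cs)
disjoint-⋃ {C = C} {[]} [] (e , p) = ∉⊥ (proj₂ (x∈p∩q⁻ C ⊥ p))
disjoint-⋃ {C = C} {D ∷ Cs} (C#D ∷ C#Cs) (e , p) with x∈p∩q⁻ C (D ∪ ⋃ Cs) p
... | c , q with x∈p∪q⁻ D (⋃ Cs) q
... | inj₁ d = C#D (e , x∈p∩q⁺ (c , d))
... | inj₂ r = disjoint-⋃ C#Cs (e , x∈p∩q⁺ (c , r))

⋃≡⨁ : {Cs : List (Subset k)} → AllPairs Disjoint Cs → ⋃ Cs ≡ ⨁ Cs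
⋃≡⨁ [] = refl
⋃≡⨁ {Cs = C ∷ Cs} (p ∷ ps) =
  trans (disjoint⇒∪≡⊕ C (⋃ Cs) (disjoint-⋃ p)) (cong (C ⊕_) (⋃≡⨁ ps))

totalSize : List (Subset k) → ℕ
totalSize Cs = total (map ∣_∣ Cs)

disjoint⇒totalSize : {Cs : List (Subset k)} → AllPairs Disjoint Cs → totalSize Cs ≡ ∣ ⨁ Cs ∣
disjoint⇒totalSize {k} [] = sym (∣⊥∣≡0 k)
disjoint⇒totalSize {Cs = C ∷ Cs} (p ∷ ps) = trans (cong (∣ C ∣ +_) (disjoint⇒totalSize ps))
  (sym (disjoint⇒∣⊕∣ C (⨁ Cs) (subst (Disjoint C) (⋃≡⨁ ps) (disjoint-⋃ p))))

⨁-++ : (As Bs : List (Subset k)) → ⨁ (As ++ Bs) ≡ ⨁ As ⊕ ⨁ Bs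
⨁-++ [] Bs = sym (⊕-identityˡ _)
⨁-++ (A ∷ As) Bs = trans (cong (A ⊕_) (⨁-++ As Bs)) (sym (⊕-assoc A _ _))

⨁-↭ : {As Bs : List (Subset k)} → As ↭ Bs → ⨁ As ≡ ⨁ Bs
⨁-↭ Perm.refl = refl
⨁-↭ (Perm.prep A p) = cong (A ⊕_) (⨁-↭ p)
⨁-↭ (Perm.swap A B p) = trans (sym (⊕-assoc A B _))
  (trans (cong₂ _⊕_ (⊕-comm A B) (⨁-↭ p)) (⊕-assoc B A _))
⨁-↭ (Perm.trans p q) = trans (⨁-↭ p) (⨁-↭ q)

-- Greedy removal with recursion on size; the invariant `𝒵` survives each removal. It serves both
-- for minimal members of a closed family and for cycles inside even edge sets.
decompose : (𝒞 𝒵 : Subset k → Set) →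
  (∀ X → 𝒵 X → Nonempty X → ∃[ C ] (𝒞 C × Nonempty C × C ⊆ X × 𝒵 (X ⊕ C))) →
  ∀ X → 𝒵 X → IsDisjointUnionOfCircuits 𝒞 X
decompose 𝒞 𝒵 remove X = go X (<-wellFounded _)
  where
  go : ∀ X → Acc _<_ ∣ X ∣ → 𝒵 X → IsDisjointUnionOfCircuits 𝒞 X
  go X (acc rec) zX with nonempty? X
  ... | no empty = [] , [] , [] , sym (Empty-unique empty)
  ... | yes ne with remove X zX ne
  ... | C , cC , neC , C⊆X , zX⊕C with go (X ⊕ C) (rec (⊆⇒∣⊕∣< {X = X} C⊆X neC)) zX⊕C
  ... | Cs , cCs , dCs , eq = C ∷ Cs , cC ∷ cCs , C#Cs ∷ dCs , trans (cong (C ∪_) eq) (⊆⇒∪-⊕ {X = X} C⊆X)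
    where
    C#Cs : All (Disjoint C) Cs
    -- The later members lie inside `X ⊕ C`, which avoids `C`.
    C#Cs = All.map (λ {D} D⊆ (e , p) → ⊆⇒disjoint-⊕ {X = X} C⊆X
      (e , x∈p∩q⁺ (proj₁ (x∈p∩q⁻ C D p) , subst (e ∈_) eq (D⊆ (proj₂ (x∈p∩q⁻ C D p))))))
      (members-⊆-⋃ Cs)

disjoint-or-extract : (C : Subset k) (Cs : List (Subset k)) → All (Disjoint C) Cs ⊎
  ∃[ D ] ∃[ Rs ] (Nonempty (C ∩ D) × Cs ↭ D ∷ Rs)
disjoint-or-extract C [] = inj₁ []
disjoint-or-extract C (D ∷ Cs) with nonempty? (C ∩ D) | disjoint-or-extract C Cs
... | yes ne | _ = inj₂ (D , Cs , ne , ↭-refl)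
... | no C#D | inj₁ C#Cs = inj₁ (C#D ∷ C#Cs)
... | no _ | inj₂ (E , Rs , ne , p) =
  inj₂ (E , D ∷ Rs , ne , ↭-trans (↭-prep D p) (↭-swap D E ↭-refl))

-- The meeting pair is brought to the front by a permutation, under which `⨁` and `totalSize` are
-- invariant.
disjoint-or-meeting : (Cs : List (Subset k)) → AllPairs Disjoint Cs ⊎
  ∃[ C ] ∃[ D ] ∃[ Rs ] (Nonempty (C ∩ D) × Cs ↭ C ∷ D ∷ Rs)
disjoint-or-meeting [] = inj₁ []
disjoint-or-meeting (C ∷ Cs) with disjoint-or-extract C Cs | disjoint-or-meeting Cs
... | inj₂ (D , Rs , ne , p) | _ = inj₂ (C , D , Rs , ne , ↭-prep C p)
... | inj₁ C#Cs | inj₁ ds = inj₁ (C#Cs ∷ ds)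
... | inj₁ _ | inj₂ (D , E , Rs , ne , p) =
  inj₂ (D , E , C ∷ Rs , ne ,
    ↭-trans (↭-prep C p) (↭-trans (↭-swap C D ↭-refl) (↭-prep D (↭-swap C E ↭-refl))))

-- Two circuits that meet are traded for a disjoint decomposition of their symmetric difference;
-- the total size drops.
⨁-circuits-disjoint : {𝒞 : Subset k → Set} → IsBinary 𝒞 →
  (Cs : List (Subset k)) → All 𝒞 Cs → IsDisjointUnionOfCircuits 𝒞 (⨁ Cs)
⨁-circuits-disjoint {𝒞 = 𝒞} binary Cs = go Cs (<-wellFounded _)
  where
  go : ∀ Cs → Acc _<_ (totalSize Cs) → All 𝒞 Cs → IsDisjointUnionOfCircuits 𝒞 (⨁ Cs)
  go Cs (acc rec) cCs with disjoint-or-meeting Cs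
  ... | inj₁ ds = Cs , cCs , ds , ⋃≡⨁ ds
  ... | inj₂ (C , D , Rs , ne , p) with All-resp-↭ p cCs
  ... | cC ∷ cD ∷ cRs with binary C D cC cD
  ... | Es , cEs , dEs , eq = subst (IsDisjointUnionOfCircuits 𝒞) same-sum (go (Es ++ Rs) (rec smaller) (++⁺ cEs cRs))
    where
    eq′ : ⨁ Es ≡ C ⊕ D
    eq′ = trans (sym (⋃≡⨁ dEs)) eq
    same-sum : ⨁ (Es ++ Rs) ≡ ⨁ Cs
    same-sum = trans (⨁-++ Es Rs) (trans (cong (_⊕ ⨁ Rs) eq′) (trans (⊕-assoc C D _) (sym (⨁-↭ p))))
    open ≤-Reasoning
    smaller : totalSize (Es ++ Rs) < totalSize Cs
    smaller = begin-strict
      totalSize (Es ++ Rs)             ≡⟨ cong total (map-++ ∣_∣ Es Rs) ⟩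
      total (map ∣_∣ Es ++ map ∣_∣ Rs) ≡⟨ sum-++ (map ∣_∣ Es) _ ⟩
      totalSize Es + totalSize Rs      ≡⟨ cong (_+ totalSize Rs) (trans (disjoint⇒totalSize dEs) (cong ∣_∣ eq′)) ⟩
      ∣ C ⊕ D ∣ + totalSize Rs         <⟨ +-monoˡ-< (totalSize Rs) (meeting⇒∣⊕∣< C D ne) ⟩
      (∣ C ∣ + ∣ D ∣) + totalSize Rs   ≡⟨ +-assoc ∣ C ∣ ∣ D ∣ _ ⟩
      totalSize (C ∷ D ∷ Rs)           ≡⟨ sum-↭ (↭-map⁺ ∣_∣ p) ⟨
      totalSize Cs                     ∎

-- Minimal members of a family closed under ⊕

module _ (𝒵 : Subset k → Set) where

  Minimal : Subset k → Set
  Minimal A = 𝒵 A × Nonempty A × (∀ B → 𝒵 B → Nonempty B → B ⊆ A → B ≡ A)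

  module _ (𝒵? : ∀ A → Dec (𝒵 A)) where

    private
      smaller? : ∀ A → Dec (∃[ B ] (𝒵 B × Nonempty B × B ⊆ A × B ≢ A))
      smaller? A = anySubset? λ B →
        𝒵? B ×-dec nonempty? B ×-dec (B ⊆? A) ×-dec ¬? (≡-dec Bool._≟_ B A)

      no-smaller : ∀ A → ¬ (∃[ B ] (𝒵 B × Nonempty B × B ⊆ A × B ≢ A)) →
        ∀ B → 𝒵 B → Nonempty B → B ⊆ A → B ≡ A
      no-smaller A none B zB neB B⊆A =
        decidable-stable (≡-dec Bool._≟_ B A) λ B≢A → none (B , zB , neB , B⊆A , B≢A)

    -- Search over the finitely many subsets decides whether a strictly smaller member exists;
    -- decidable equality turns its absence into the universal clause.
    minimal? : ∀ A → Dec (Minimal A)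
    minimal? A = 𝒵? A ×-dec nonempty? A ×-dec map′ (no-smaller A)
      (λ min (B , zB , neB , B⊆A , B≢A) → B≢A (min B zB neB B⊆A)) (¬? (smaller? A))

    minimal-below : ∀ X → 𝒵 X → Nonempty X → ∃[ C ] (Minimal C × C ⊆ X)
    minimal-below X = go X (<-wellFounded _)
      where
      go : ∀ X → Acc _<_ ∣ X ∣ → 𝒵 X → Nonempty X → ∃[ C ] (Minimal C × C ⊆ X)
      go X (acc rec) zX neX with smaller? X
      ... | no none = X , (zX , neX , no-smaller X none) , ⊆-refl
      ... | yes (B , zB , neB , B⊆X , B≢X) with go B (rec (p⊂q⇒∣p∣<∣q∣ B⊂X)) zB neB
        where
        B⊂X : B ⊂ X
        B⊂X with any? (λ e → (e ∈? X) ×-dec ¬? (e ∈? B))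
        ... | yes (e , e∈X , e∉B) = B⊆X , e , e∈X , e∉B
        ... | no none = contradiction
          (⊆-antisym B⊆X λ {e} e∈X → decidable-stable (e ∈? B) λ e∉B → none (e , e∈X , e∉B)) B≢X
      ... | C , min , C⊆B = C , min , ⊆-trans C⊆B B⊆X

    module _ (𝒵-⊕ : ∀ A B → 𝒵 A → 𝒵 B → 𝒵 (A ⊕ B)) where

      minimal-decomposition : ∀ X → 𝒵 X → IsDisjointUnionOfCircuits Minimal X
      minimal-decomposition = decompose Minimal 𝒵 λ X zX neX →
        let C , min , C⊆X = minimal-below X zX neX
        in C , min , proj₁ (proj₂ min) , C⊆X , 𝒵-⊕ X C zX (proj₁ min)

      -- Incomparability is minimality itself. For elimination, `A ⊕ B` stays in the family, is
      -- nonempty because `A` and `B` differ, and misses the shared element, so any minimal member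
      -- below it serves.
      minimal-isMatroid : IsMatroid Minimal
      minimal-isMatroid = record
        { nonempty = λ A min → proj₁ (proj₂ min)
        ; incomparable = λ A B (zA , neA , _) (_ , _ , minB) A⊆B → minB A zA neA A⊆B
        ; elimination = λ A B e (zA , _) (zB , _) A≢B e∈ →
            let C , min , C⊆ = minimal-below (A ⊕ B) (𝒵-⊕ A B zA zB) (≢⇒⊕-nonempty A B A≢B)
            in C , min , ⊆-trans C⊆ (⊕-⊆-minus A B e∈)
        }

      minimal-isBinary : IsBinary Minimal
      minimal-isBinary A B (zA , _) (zB , _) = minimal-decomposition (A ⊕ B) (𝒵-⊕ A B zA zB)

-- Images of subsets under a bijection

module _ {m k : ℕ} (f : Fin m ↔ Fin k) where
  open Inverse f

  lookup-image : ∀ A y → lookup (image f A) y ≡ lookup A (from y)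
  lookup-image A = lookup∘tabulate _

  image-⊕ : ∀ A B → image f (A ⊕ B) ≡ image f A ⊕ image f B
  image-⊕ A B = subset-ext λ y → trans (lookup-image (A ⊕ B) y) (trans (lookup-⊕ A B (from y))
    (trans (sym (cong₂ _xor_ (lookup-image A y) (lookup-image B y))) (sym (lookup-⊕ (image f A) (image f B) y))))

  image-⊥ : image f ⊥ ≡ ⊥
  image-⊥ = trans (cong (image f) (sym (⊕-self ⊥))) (trans (image-⊕ ⊥ ⊥) (⊕-self (image f ⊥)))

  ⨁-image : ∀ Cs → ⨁ (map (image f) Cs) ≡ image f (⨁ Cs)
  ⨁-image [] = sym image-⊥
  ⨁-image (C ∷ Cs) = trans (cong (image f C ⊕_) (⨁-image Cs)) (sym (image-⊕ C (⨁ Cs)))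

  image-mono : ∀ {A B} → A ⊆ B → image f A ⊆ image f B
  image-mono {A} {B} A⊆B {y} y∈ = ∈⁺ (trans (lookup-image B y)
    ([]=⇒lookup (A⊆B (∈⁺ (trans (sym (lookup-image A y)) ([]=⇒lookup y∈))))))

  ∈-image⁺ : ∀ {A x} → x ∈ A → to x ∈ image f A
  ∈-image⁺ {A} {x} x∈ = ∈⁺ (trans (lookup-image A (to x))
    (trans (cong (lookup A) (strictlyInverseʳ x)) ([]=⇒lookup x∈)))

  ∈-image⁻ : ∀ {A x} → to x ∈ image f A → x ∈ A
  ∈-image⁻ {A} {x} p = ∈⁺ (trans (cong (lookup A) (sym (strictlyInverseʳ x)))
    (trans (sym (lookup-image A (to x))) ([]=⇒lookup p)))

  preimage : Subset k → Subset m
  preimage B = tabulate (lookup B ∘ to)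

  image-preimage : ∀ B → image f (preimage B) ≡ B
  image-preimage B = subset-ext λ y → trans (lookup-image (preimage B) y)
    (trans (lookup∘tabulate _ (from y)) (cong (lookup B) (strictlyInverseˡ y)))

-- Sums modulo 2

module 𝔽₂ = Sum (CommutativeRing.semiring xor-∧-commutativeRing)

δ : Fin n → Fin n → Bool
δ u v = does (u ≟ v)

δ-refl : (u : Fin n) → δ u u ≡ true
δ-refl u = dec-true (u ≟ u) refl

δ-≢ : {u v : Fin n} → u ≢ v → δ u v ≡ false
δ-≢ {u = u} {v} = dec-false (u ≟ v)

does-true⇒ : {P : Set} (P? : Dec P) → does P? ≡ true → P
does-true⇒ (yes p) _ = p

δ⇒≡ : {u v : Fin n} → δ u v ≡ true → u ≡ v
δ⇒≡ {u = u} {v} = does-true⇒ (u ≟ v)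

∧-true : ∀ {a b} → a ∧ b ≡ true → a ≡ true × b ≡ true
∧-true {true} eq = refl , eq

xor-trans : ∀ a b c → (a xor b) xor (b xor c) ≡ a xor c
xor-trans a b c = trans (xor-assoc a b _) (cong (a xor_) (trans (sym (xor-assoc b b c)) (cong (_xor c) (xor-same b))))

sum-false : {f : Fin n → Bool} → (∀ i → f i ≡ false) → 𝔽₂.sum f ≡ false
sum-false {n} f≡ = trans (𝔽₂.sum-cong-≗ f≡) (𝔽₂.sum-replicate-zero n)

sum-single : (f : Fin n → Bool) (i : Fin n) → (∀ j → j ≢ i → f j ≡ false) → 𝔽₂.sum f ≡ f i
sum-single f zero f≡ = trans (cong (f zero xor_) (sum-false λ j → f≡ (suc j) λ ())) (xor-identityʳ _)
sum-single f (suc i) f≡ = trans (cong (_xor 𝔽₂.sum (f ∘ suc)) (f≡ zero λ ()))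
  (sum-single (f ∘ suc) i λ j j≢i → f≡ (suc j) (j≢i ∘ suc-injective))

sum-true⇒∃ : (f : Fin n → Bool) → 𝔽₂.sum f ≡ true → ∃[ i ] f i ≡ true
sum-true⇒∃ {suc n} f eq with f zero in f0
... | true = zero , f0
... | false with sum-true⇒∃ (f ∘ suc) eq
... | i , fi = suc i , fi

-- If `i` were the only true position, `sum-single` would make the sum true.
sum-false⇒another : (f : Fin n → Bool) (i : Fin n) → 𝔽₂.sum f ≡ false → f i ≡ true →
  ∃[ j ] (j ≢ i × f j ≡ true)
sum-false⇒another f i sum≡ fi with any? (λ j → ¬? (j ≟ i) ×-dec (f j Bool.≟ true))
... | yes found = found
... | no none = contradiction
  (trans (sym fi) (trans (sym (sum-single f i λ j j≢i → ¬-not λ fj → none (j , j≢i , fj))) sum≡)) λ ()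

sum-∧-δ : (T : Fin n → Bool) (w : Fin n) → 𝔽₂.sum (λ v → T v ∧ δ v w) ≡ T w
sum-∧-δ T w = trans (sum-single _ w λ v v≢w → trans (cong (T v ∧_) (δ-≢ v≢w)) (∧-zeroʳ (T v)))
  (trans (cong (T w ∧_) (δ-refl w)) (∧-identityʳ (T w)))

sum-δ : (u : Fin n) → 𝔽₂.sum (δ u) ≡ true
sum-δ u = trans (sum-single (δ u) u λ v v≢u → δ-≢ (v≢u ∘ sym)) (δ-refl u)

lookup-⁅⁆ : (e e′ : Fin m) → lookup ⁅ e ⁆ e′ ≡ δ e e′
lookup-⁅⁆ e e′ with e ≟ e′
... | yes refl = []=⇒lookup (x∈⁅x⁆ e)
... | no e≢e′ = ¬-not λ eq → e≢e′ (sym (x∈⁅y⁆⇒x≡y e (∈⁺ eq)))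

odd : ℕ → Bool
odd zero = false
odd (suc n) = not (odd n)

2∣⇒odd≡false : ∀ {n} → 2 ∣ n → odd n ≡ false
2∣⇒odd≡false (divides q refl) = go q
  where
  go : ∀ q → odd (q * 2) ≡ false
  go zero = refl
  go (suc q) = trans (not-involutive _) (go q)

¬2∣⇒odd≡true : ∀ n → ¬ 2 ∣ n → odd n ≡ true
¬2∣⇒odd≡true 0 ¬2∣ = contradiction (2 ∣0) ¬2∣
¬2∣⇒odd≡true 1 ¬2∣ = refl
¬2∣⇒odd≡true (suc (suc n)) ¬2∣ =
  trans (not-involutive _) (¬2∣⇒odd≡true n λ 2∣n → ¬2∣ (∣m∣n⇒∣m+n ∣-refl 2∣n))

sum-lookup : ∀ {n} (S : Subset n) → 𝔽₂.sum (lookup S) ≡ odd ∣ S ∣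
sum-lookup [] = refl
sum-lookup (true ∷ S) = cong not (sum-lookup S)
sum-lookup (false ∷ S) = sum-lookup S

sum-true : ∀ n → 𝔽₂.sum {n} (λ _ → true) ≡ odd n
sum-true zero = refl
sum-true (suc n) = cong not (sum-true n)

-- Boundaries and cycles

module _ {n m : ℕ} (G : Graph n m) where
  open Graph G

  private
    J : Fin m → Fin n → Fin n → Set
    J = Joins src tgt

    next′ : ∀ {k} → Fin (suc k) → Fin (suc k)
    next′ = next G

  next-inject₁ : (i : Fin k) → next′ (inject₁ i) ≡ suc i
  next-inject₁ {k} i = toℕ-injective (trans (toℕ-fromℕ< _)
    (trans (cong (λ x → suc x % suc k) (toℕ-inject₁ i)) (m<n⇒m%n≡m (s≤s (toℕ<n i)))))

  next-fromℕ : ∀ k → next′ (fromℕ k) ≡ zero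
  next-fromℕ k = toℕ-injective (trans (toℕ-fromℕ< _)
    (trans (cong (λ x → suc x % suc k) (toℕ-fromℕ k)) (n%n≡0 (suc k))))

  prev : Fin (suc k) → Fin (suc k)
  prev zero = fromℕ _
  prev (suc i) = inject₁ i

  next-prev : (i : Fin (suc k)) → next′ (prev i) ≡ i
  next-prev zero = next-fromℕ _
  next-prev (suc i) = next-inject₁ i

  prev-next : (i : Fin (suc k)) → prev (next′ i) ≡ i
  prev-next i with view i
  ... | ‵fromℕ = cong prev (next-fromℕ _)
  ... | ‵inject₁ j = cong prev (next-inject₁ j)

  next-injective : {i j : Fin (suc k)} → next′ i ≡ next′ j → i ≡ j
  next-injective {i = i} {j} eq = trans (sym (prev-next i)) (trans (cong prev eq) (prev-next j))

  -- Holds only from length three on; this keeps a cycle from traversing one edge in both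
  -- directions.
  next-next≢ : (i : Fin (3 + k)) → next′ (next′ i) ≢ i
  next-next≢ i eq with view i
  ... | ‵fromℕ with () ← trans (sym eq) (trans (cong next′ (next-fromℕ _)) (next-inject₁ zero))
  ... | ‵inject₁ j with view j
  ... | ‵fromℕ with () ← trans (sym eq) (trans (cong next′ (next-inject₁ (fromℕ _))) (next-fromℕ _))
  ... | ‵inject₁ l = <⇒≢ (m≤n⇒m≤1+n (n<1+n (toℕ l)))
    (sym (trans (cong toℕ step) (trans (toℕ-inject₁ (inject₁ l)) (toℕ-inject₁ l))))
    where
    step : suc (suc l) ≡ inject₁ (inject₁ l)
    step = trans (sym (trans (cong next′ (next-inject₁ (inject₁ l))) (next-inject₁ (suc l)))) eq

  sum-next : (f : Fin (suc k) → Bool) → 𝔽₂.sum (f ∘ next′) ≡ 𝔽₂.sum f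
  sum-next f = sym (𝔽₂.sum-permute f (permutation next′ prev next-prev prev-next))

  -- Step from `i` up to the last index, wrap around to `zero`, then climb to every index.
  next-closed⇒all : (P : Fin (suc k) → Set) → (∀ i → P i → P (next′ i)) → ∀ i → P i → ∀ j → P j
  next-closed⇒all P step i Pi = <-weakInduction P
    (>-weakInduction (λ i → P i → P zero)
      (λ p → subst P (next-fromℕ _) (step _ p))
      (λ i ih p → ih (subst P (next-inject₁ i) (step _ p))) i Pi)
    (λ i p → subst P (next-inject₁ i) (step _ p))

  -- Incidence modulo 2. As there are no loops, the exclusive or agrees with having `v` as an end,
  -- and it splits degree parities into sums of vertex indicators.
  inc : Fin m → Fin n → Bool
  inc e v = δ (src e) v xor δ (tgt e) v

  ∂ : Subset m → Fin n → Bool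
  ∂ A v = 𝔽₂.sum λ e → lookup A e ∧ inc e v

  Even : Subset m → Set
  Even A = ∀ v → ∂ A v ≡ false

  joins-inc : ∀ {e u v} → J e u v → ∀ w → inc e w ≡ δ u w xor δ v w
  joins-inc (inj₁ (refl , refl)) w = refl
  joins-inc {e} (inj₂ (refl , refl)) w = xor-comm (δ (src e) w) _

  inc⇒joins : ∀ {e v} → inc e v ≡ true → ∃[ w ] J e v w
  inc⇒joins {e} {v} eq with src e ≟ v
  ... | yes p = tgt e , inj₁ (p , refl)
  ... | no _ = src e , inj₂ (refl , δ⇒≡ eq)

  joins-≢ : ∀ {e u v} → J e u v → u ≢ v
  joins-≢ {e} (inj₁ (refl , refl)) = loopless e
  joins-≢ {e} (inj₂ (refl , refl)) = loopless e ∘ sym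

  joins⇒inc : ∀ {e u v} → J e u v → inc e u ≡ true
  joins⇒inc {u = u} {v} j = trans (joins-inc j u)
    (cong₂ _xor_ (δ-refl u) (δ-≢ (joins-≢ j ∘ sym)))

  inc⇒end : ∀ {e u v w} → J e u v → inc e w ≡ true → u ≡ w ⊎ v ≡ w
  inc⇒end {u = u} {w = w} j eq with u ≟ w | trans (sym (joins-inc j w)) eq
  ... | yes p | _ = inj₁ p
  ... | no _ | q = inj₂ (δ⇒≡ q)

  joins-unique : ∀ {e e′ u v} → J e u v → J e′ u v → e ≡ e′
  joins-unique {e} {e′} (inj₁ (refl , refl)) j = no-multi e e′ j
  joins-unique {e} {e′} (inj₂ (refl , refl)) j = no-multi e e′ (swap j)

  joins-ends : ∀ {e u v u′ v′} → J e u v → J e u′ v′ →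
    (u ≡ u′ × v ≡ v′) ⊎ (u ≡ v′ × v ≡ u′)
  joins-ends (inj₁ (refl , refl)) (inj₁ (refl , refl)) = inj₁ (refl , refl)
  joins-ends (inj₁ (refl , refl)) (inj₂ (refl , refl)) = inj₂ (refl , refl)
  joins-ends (inj₂ (refl , refl)) (inj₁ (refl , refl)) = inj₂ (refl , refl)
  joins-ends (inj₂ (refl , refl)) (inj₂ (refl , refl)) = inj₁ (refl , refl)

  ∂-⊕ : ∀ A B v → ∂ (A ⊕ B) v ≡ ∂ A v xor ∂ B v
  ∂-⊕ A B v = trans
    (𝔽₂.sum-cong-≗ λ e → trans (cong (_∧ inc e v) (lookup-⊕ A B e)) (∧-distribʳ-xor (inc e v) (lookup A e) (lookup B e)))
    (𝔽₂.∑-distrib-+ (λ e → lookup A e ∧ inc e v) (λ e → lookup B e ∧ inc e v))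

  ∂-⊥ : Even ⊥
  ∂-⊥ v = sum-false λ e → cong (_∧ inc e v) (lookup-replicate e false)

  ∂-⁅⁆ : ∀ e v → ∂ ⁅ e ⁆ v ≡ inc e v
  ∂-⁅⁆ e v = trans (sum-single _ e λ e′ e′≢e → cong (_∧ inc e′ v) (trans (lookup-⁅⁆ e e′) (δ-≢ (e′≢e ∘ sym))))
    (cong (_∧ inc e v) (trans (lookup-⁅⁆ e e) (δ-refl e)))

  ∂-true⇒∃ : ∀ A v → ∂ A v ≡ true → ∃[ e ] (e ∈ A × inc e v ≡ true)
  ∂-true⇒∃ A v eq with sum-true⇒∃ _ eq
  ... | e , p = e , ∈⁺ (proj₁ (∧-true p)) , proj₂ (∧-true {lookup A e} p)

  even⇒another : ∀ {A v e} → Even A → e ∈ A → inc e v ≡ true →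
    ∃[ e′ ] (e′ ≢ e × e′ ∈ A × inc e′ v ≡ true)
  even⇒another {A} {v} {e} even e∈A ev
    with sum-false⇒another _ e (even v) (cong₂ _∧_ ([]=⇒lookup e∈A) ev)
  ... | e′ , e′≢e , p = e′ , e′≢e , ∈⁺ (proj₁ (∧-true p)) , proj₂ (∧-true {lookup A e′} p)

  -- Exchanging the two sums leaves, for each edge of `A`, its two ends, which cancel modulo 2.
  handshake : ∀ A → 𝔽₂.sum (∂ A) ≡ false
  handshake A = begin
    𝔽₂.sum (λ v → 𝔽₂.sum λ e → lookup A e ∧ inc e v)  ≡⟨ 𝔽₂.∑-comm (λ v e → lookup A e ∧ inc e v) ⟩
    𝔽₂.sum (λ e → 𝔽₂.sum λ v → lookup A e ∧ inc e v)  ≡⟨ sum-false zero-sum ⟩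
    false                                              ∎
    where
    open ≡-Reasoning
    zero-sum : ∀ e → 𝔽₂.sum (λ v → lookup A e ∧ inc e v) ≡ false
    zero-sum e = trans (sym (𝔽₂.*-distribˡ-sum (lookup A e) (inc e)))
      (trans (cong (lookup A e ∧_) (trans (𝔽₂.∑-distrib-+ (δ (src e)) (δ (tgt e)))
        (cong₂ _xor_ (sum-δ (src e)) (sum-δ (tgt e))))) (∧-zeroʳ (lookup A e)))

  -- Such a `Y` is a `T`-join inside `A`, with `T` the support of `f`.
  Spans : Subset m → (Fin n → Bool) → Set
  Spans A f = ∃[ Y ] (Y ⊆ A × ∀ w → ∂ Y w ≡ f w)

  spans-resp : ∀ {A f g} → (∀ w → f w ≡ g w) → Spans A f → Spans A g
  spans-resp f≡g (Y , Y⊆ , eq) = Y , Y⊆ , λ w → trans (eq w) (f≡g w)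

  spans-mono : ∀ {A B f} → A ⊆ B → Spans A f → Spans B f
  spans-mono A⊆B (Y , Y⊆A , eq) = Y , ⊆-trans Y⊆A A⊆B , eq

  spans-zero : ∀ {A} → Spans A (λ _ → false)
  spans-zero = ⊥ , (λ x∈ → contradiction x∈ ∉⊥) , ∂-⊥

  spans-⊕ : ∀ {A f g} → Spans A f → Spans A g → Spans A (λ w → f w xor g w)
  spans-⊕ {A} (Y , Y⊆ , f≡) (Z , Z⊆ , g≡) =
    Y ⊕ Z , Y⊕Z⊆ , λ w → trans (∂-⊕ Y Z w) (cong₂ _xor_ (f≡ w) (g≡ w))
    where
    Y⊕Z⊆ : (Y ⊕ Z) ⊆ A
    Y⊕Z⊆ {e} p with lookup Y e in y | lookup Z e in z
    ... | true | _ = Y⊆ (∈⁺ y)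
    ... | false | true = Z⊆ (∈⁺ z)
    ... | false | false with () ← trans (sym ([]=⇒lookup p)) (trans (lookup-⊕ Y Z e) (cong₂ _xor_ y z))

  spans-edge : ∀ {A e u v} → e ∈ A → J e u v → Spans A (λ w → δ u w xor δ v w)
  spans-edge {e = e} e∈A j = ⁅ e ⁆ , (λ x∈ → subst (_∈ _) (sym (x∈⁅y⁆⇒x≡y e x∈)) e∈A) ,
    λ w → trans (∂-⁅⁆ e w) (joins-inc j w)

  spans-sum : ∀ {A} (f : Fin k → Fin n → Bool) → (∀ i → Spans A (f i)) →
    Spans A (λ w → 𝔽₂.sum λ i → f i w)
  spans-sum {zero} f spans = spans-zero
  spans-sum {suc k} f spans = spans-⊕ (spans zero) (spans-sum (f ∘ suc) (spans ∘ suc))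

  -- Each v in T contributes the pair {v₀ , v}; v₀ cancels because T has even size.
  spans-join : ∀ A T v₀ → 𝔽₂.sum T ≡ false →
    (∀ v → T v ≡ true → Spans A (λ w → δ v₀ w xor δ v w)) → Spans A T
  spans-join A T v₀ even spans = spans-resp total≡T (spans-sum _ each)
    where
    each : ∀ v → Spans A (λ w → T v ∧ (δ v₀ w xor δ v w))
    each v with T v in Tv
    ... | true = spans v Tv
    ... | false = spans-zero
    total≡T : ∀ w → 𝔽₂.sum (λ v → T v ∧ (δ v₀ w xor δ v w)) ≡ T w
    total≡T w = begin
      𝔽₂.sum (λ v → T v ∧ (δ v₀ w xor δ v w))
        ≡⟨ 𝔽₂.sum-cong-≗ (λ v → ∧-distribˡ-xor (T v) _ _) ⟩
      𝔽₂.sum (λ v → (T v ∧ δ v₀ w) xor (T v ∧ δ v w))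
        ≡⟨ 𝔽₂.∑-distrib-+ (λ v → T v ∧ δ v₀ w) _ ⟩
      𝔽₂.sum (λ v → T v ∧ δ v₀ w) xor 𝔽₂.sum (λ v → T v ∧ δ v w)
        ≡⟨ cong₂ _xor_ (sym (𝔽₂.*-distribʳ-sum (δ v₀ w) T)) (sum-∧-δ T w) ⟩
      (𝔽₂.sum T ∧ δ v₀ w) xor T w
        ≡⟨ cong (λ s → (s ∧ δ v₀ w) xor T w) even ⟩
      T w ∎
      where open ≡-Reasoning

  -- Edge sets of cycles

  module _ (c : Cycle G) where
    open Cycle c

    -- Canonical form of a circuit: by `edgeSet-unique` every subset satisfying `EdgeSetOf` equals
    -- this one.
    edgeSet : Subset m
    edgeSet = tabulate λ e → does (any? λ i → es i ≟ e)

    ∈-edgeSet⁻ : ∀ {e} → e ∈ edgeSet → ∃[ i ] es i ≡ e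
    ∈-edgeSet⁻ {e} p = does-true⇒ (any? λ i → es i ≟ e) (trans (sym (lookup∘tabulate _ e)) ([]=⇒lookup p))

    es∈edgeSet : ∀ i → es i ∈ edgeSet
    es∈edgeSet i = ∈⁺ (trans (lookup∘tabulate _ (es i)) (dec-true (any? λ j → es j ≟ es i) (i , refl)))

    edgeSet-correct : EdgeSetOf G c edgeSet
    edgeSet-correct e = mk⇔ ∈-edgeSet⁻ λ { (i , refl) → es∈edgeSet i }

    edgeSet-unique : ∀ {A} → EdgeSetOf G c A → A ≡ edgeSet
    edgeSet-unique {A} corr = ⊆-antisym
      (λ {e} e∈ → subst (_∈ edgeSet) (proj₂ (Equivalence.to (corr e) e∈)) (es∈edgeSet _))
      (λ {e} e∈ → Equivalence.from (corr e) (∈-edgeSet⁻ e∈))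

    -- Equal edges have equal ends. Matched in order, these identify the indices; matched crosswise,
    -- they would give `next′ (next′ i) ≡ i`.
    es-injective : ∀ {i j} → es i ≡ es j → i ≡ j
    es-injective {i} {j} eq
      with joins-ends (es-joins i) (subst (λ e → J e _ _) (sym eq) (es-joins j))
    ... | inj₁ (p , _) = vs-inj p
    ... | inj₂ (p , q) = contradiction (trans (cong next′ (vs-inj q)) (sym (vs-inj p))) (next-next≢ i)

    -- By injectivity of `es` each edge is counted at most once, so the parity sum is the membership
    -- bit.
    lookup-edgeSet : ∀ e → lookup edgeSet e ≡ 𝔽₂.sum (λ i → δ (es i) e)
    lookup-edgeSet e with lookup edgeSet e in p
    ... | false = sym (sum-false λ i → δ-≢ λ eq →
      contradiction (trans (sym p) ([]=⇒lookup (subst (_∈ edgeSet) eq (es∈edgeSet i)))) λ ())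
    ... | true with ∈-edgeSet⁻ (∈⁺ p)
    ... | i , refl = sym (trans (sum-single _ i λ j j≢i → δ-≢ (j≢i ∘ es-injective)) (δ-refl (es i)))

    -- Start vertices and end vertices of the edges give the same total, since `next′` permutes the
    -- indices; the two totals cancel.
    edgeSet-even : Even edgeSet
    edgeSet-even v = begin
      𝔽₂.sum (λ e → lookup edgeSet e ∧ inc e v)
        ≡⟨ 𝔽₂.sum-cong-≗ (λ e → trans (cong (_∧ inc e v) (lookup-edgeSet e)) (𝔽₂.*-distribʳ-sum (inc e v) (λ i → δ (es i) e))) ⟩
      𝔽₂.sum (λ e → 𝔽₂.sum λ i → δ (es i) e ∧ inc e v)
        ≡⟨ 𝔽₂.∑-comm (λ e i → δ (es i) e ∧ inc e v) ⟩
      𝔽₂.sum (λ i → 𝔽₂.sum λ e → δ (es i) e ∧ inc e v)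
        ≡⟨ 𝔽₂.sum-cong-≗ (λ i → trans
             (sum-single _ (es i) λ e e≢ → cong (_∧ inc e v) (δ-≢ (e≢ ∘ sym)))
             (cong (_∧ inc (es i) v) (δ-refl (es i)))) ⟩
      𝔽₂.sum (λ i → inc (es i) v)
        ≡⟨ 𝔽₂.sum-cong-≗ (λ i → joins-inc (es-joins i) v) ⟩
      𝔽₂.sum (λ i → δ (vs i) v xor δ (vs (next′ i)) v)
        ≡⟨ 𝔽₂.∑-distrib-+ (λ i → δ (vs i) v) (λ i → δ (vs (next′ i)) v) ⟩
      𝔽₂.sum (λ i → δ (vs i) v) xor 𝔽₂.sum (λ i → δ (vs (next′ i)) v)
        ≡⟨ cong (𝔽₂.sum (λ i → δ (vs i) v) xor_) (sum-next (λ i → δ (vs i) v)) ⟩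
      𝔽₂.sum (λ i → δ (vs i) v) xor 𝔽₂.sum (λ i → δ (vs i) v)
        ≡⟨ xor-same (𝔽₂.sum λ i → δ (vs i) v) ⟩
      false ∎
      where open ≡-Reasoning

    es-inc : ∀ {i v} → inc (es i) v ≡ true → vs i ≡ v ⊎ vs (next′ i) ≡ v
    es-inc {i} = inc⇒end (es-joins i)

    edgeSet-nonempty : Nonempty edgeSet
    edgeSet-nonempty = es zero , es∈edgeSet zero

    -- Only `es i` and `es (next′ i)` meet the vertex `vs (next′ i)` on the cycle, so evenness of
    -- `B` there passes membership from one to the other, and so around the whole cycle.
    edgeSet-minimal : ∀ {B} → B ⊆ edgeSet → Nonempty B → Even B → B ≡ edgeSet
    edgeSet-minimal {B} B⊆ (e , e∈B) even = ⊆-antisym B⊆ λ {e′} e′∈ →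
      subst (_∈ B) (proj₂ (∈-edgeSet⁻ e′∈)) (all∈ (proj₁ (∈-edgeSet⁻ e′∈)))
      where
      step : ∀ i → es i ∈ B → es (next′ i) ∈ B
      step i i∈B with even⇒another {v = vs (next′ i)} even i∈B (joins⇒inc (swap (es-joins i)))
      ... | e″ , e″≢ , e″∈ , incident with ∈-edgeSet⁻ (B⊆ e″∈)
      ... | j , refl with es-inc incident
      ... | inj₁ p = subst (λ l → es l ∈ B) (vs-inj p) e″∈
      ... | inj₂ p = contradiction (cong es (next-injective (vs-inj p))) e″≢
      all∈ : ∀ i → es i ∈ B
      all∈ = next-closed⇒all (λ i → es i ∈ B) step (proj₁ (∈-edgeSet⁻ (B⊆ e∈B)))
        (subst (_∈ B) (sym (proj₂ (∈-edgeSet⁻ (B⊆ e∈B)))) e∈B)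

    edge-onCycle : ∀ {e v} → e ∈ edgeSet → inc e v ≡ true → OnCycle G c v
    edge-onCycle e∈ incident with ∈-edgeSet⁻ e∈
    ... | i , refl with es-inc incident
    ... | inj₁ p = i , p
    ... | inj₂ p = next′ i , p

    ∂-onCycle : ∀ {B v} → B ⊆ edgeSet → ∂ B v ≡ true → OnCycle G c v
    ∂-onCycle {B} {v} B⊆ eq with ∂-true⇒∃ B v eq
    ... | e , e∈B , incident = edge-onCycle (B⊆ e∈B) incident

    -- The edges before index `i` form an arc from `vs zero`, and their boundaries telescope.
    spans-arc : ∀ i → Spans edgeSet (λ w → δ (vs zero) w xor δ (vs i) w)
    spans-arc = <-weakInduction _ (spans-resp (λ w → sym (xor-same (δ (vs zero) w))) spans-zero)
      λ i ih → spans-resp (λ w → xor-trans (δ (vs zero) w) (δ (vs (inject₁ i)) w) (δ (vs (suc i)) w))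
        (spans-⊕ ih (spans-edge (es∈edgeSet (inject₁ i))
          (subst (λ j → J (es (inject₁ i)) (vs (inject₁ i)) (vs j)) (next-inject₁ i) (es-joins (inject₁ i)))))

  -- Even edge sets and the cycles inside them

  even-⊕ : ∀ A B → Even A → Even B → Even (A ⊕ B)
  even-⊕ A B evA evB v = trans (∂-⊕ A B v) (cong₂ _xor_ (evA v) (evB v))

  even? : ∀ A → Dec (Even A)
  even? A = all? λ v → ∂ A v Bool.≟ false

  -- Indexing by `ℕ`, with conditions only up to `l`, lets vertices be prepended without casts
  -- between finite types.
  record Path (X : Subset m) (l : ℕ) : Set where
    field
      v : ℕ → Fin n
      p : ℕ → Fin m
      v-inj : ∀ {i j} → i ≤ l → j ≤ l → v i ≡ v j → i ≡ j
      joins : ∀ {i} → i < l → J (p i) (v i) (v (suc i))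
      inside : ∀ {i} → i < l → p i ∈ X

  path-bound : ∀ {X l} → Path X l → l < n
  path-bound P = injective⇒≤ {f = v ∘ toℕ} λ {i} {j} eq →
    toℕ-injective (v-inj (s≤s⁻¹ (toℕ<n i)) (s≤s⁻¹ (toℕ<n j)) eq)
    where open Path P

  edge-path : ∀ {X e} → e ∈ X → Path X 1
  edge-path {X} {e} e∈X = record
    { v = v ; p = λ _ → e ; v-inj = v-inj
    ; joins = λ { (s≤s z≤n) → inj₁ (refl , refl) } ; inside = λ _ → e∈X }
    where
    v : ℕ → Fin n
    v zero = src e
    v (suc _) = tgt e
    v-inj : ∀ {i j} → i ≤ 1 → j ≤ 1 → v i ≡ v j → i ≡ j
    v-inj z≤n z≤n eq = refl
    v-inj z≤n (s≤s z≤n) eq = contradiction eq (loopless e)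
    v-inj (s≤s z≤n) z≤n eq = contradiction (sym eq) (loopless e)
    v-inj (s≤s z≤n) (s≤s z≤n) eq = refl

  prepend : ∀ {X l e w} (P : Path X l) → e ∈ X → J e w (Path.v P 0) →
    (∀ {j} → j ≤ l → Path.v P j ≢ w) → Path X (suc l)
  prepend {X} {l} {e} {w} P e∈X j new = record
    { v = v′ ; p = p′ ; v-inj = inj′ ; joins = joins′ ; inside = inside′ }
    where
    open Path P
    v′ : ℕ → Fin n
    v′ zero = w
    v′ (suc i) = v i
    p′ : ℕ → Fin m
    p′ zero = e
    p′ (suc i) = p i
    inj′ : ∀ {i j} → i ≤ suc l → j ≤ suc l → v′ i ≡ v′ j → i ≡ j
    inj′ z≤n z≤n eq = refl
    inj′ z≤n (s≤s j≤) eq = contradiction (sym eq) (new j≤)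
    inj′ (s≤s i≤) z≤n eq = contradiction eq (new i≤)
    inj′ (s≤s i≤) (s≤s j≤) eq = cong suc (v-inj i≤ j≤ eq)
    joins′ : ∀ {i} → i < suc l → J (p′ i) (v′ i) (v′ (suc i))
    joins′ {zero} _ = j
    joins′ {suc i} (s≤s i<l) = joins i<l
    inside′ : ∀ {i} → i < suc l → p′ i ∈ X
    inside′ {zero} _ = e∈X
    inside′ {suc i} (s≤s i<l) = inside i<l

  -- The stretch from vertex `0` to vertex `2 + k`, closed by `e`, has `3 + k` vertices. `view`
  -- separates the last index, which carries `e`, from those carrying path edges.
  close : ∀ {X l e} (P : Path X l) k → 2 + k ≤ l → e ∈ X →
    J e (Path.v P (2 + k)) (Path.v P 0) → ∃[ c ] edgeSet c ⊆ X
  close {X} {l} {e} P k k≤ e∈X closing = c , λ p → subst (_∈ X) (proj₂ (∈-edgeSet⁻ c p)) (es∈X (proj₁ (∈-edgeSet⁻ c p)))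
    where
    open Path P
    below : (i : Fin (2 + k)) → toℕ i < l
    below i = <-≤-trans (toℕ<n i) k≤
    es : Fin (3 + k) → Fin m
    es i with view i
    ... | ‵fromℕ = e
    ... | ‵inject₁ j = p (toℕ j)
    es-joins : ∀ i → J (es i) (v (toℕ i)) (v (toℕ (next G i)))
    es-joins i with view i
    ... | ‵fromℕ = subst₂ (λ a b → J e (v a) (v b))
      (sym (toℕ-fromℕ (2 + k))) (cong toℕ (sym (next-fromℕ (2 + k)))) closing
    ... | ‵inject₁ j = subst₂ (λ a b → J (p (toℕ j)) (v a) (v b))
      (sym (toℕ-inject₁ j)) (cong toℕ (sym (next-inject₁ j))) (joins (below j))
    es∈X : ∀ i → es i ∈ X
    es∈X i with view i
    ... | ‵fromℕ = e∈X
    ... | ‵inject₁ j = inside (below j)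
    c : Cycle G
    c = record
      { k = k ; vs = v ∘ toℕ
      ; vs-inj = λ {i} {j} eq → toℕ-injective
          (v-inj (≤-trans (s≤s⁻¹ (toℕ<n i)) k≤) (≤-trans (s≤s⁻¹ (toℕ<n j)) k≤) eq)
      ; es = es ; es-joins = es-joins }

  -- Evenness supplies a second edge at the head; its other end is new or closes a cycle of length at least 3.
  extend : ∀ {X l} → Even X → Path X (suc l) → (∃[ c ] edgeSet c ⊆ X) ⊎ Path X (2 + l)
  extend {X} {l} even P
    with even⇒another {v = Path.v P 0} even (Path.inside P (s≤s z≤n)) (joins⇒inc (Path.joins P (s≤s z≤n)))
  ... | e , e≢ , e∈X , incident with inc⇒joins incident
  ... | w , j with anyUpTo? (λ i → Path.v P i ≟ w) (2 + l)
  ... | no new = inj₂ (prepend P e∈X (swap j) λ {i} i≤ eq → new (i , s≤s i≤ , eq))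
  -- A return to vertex `0` would make `e` a loop; a return to vertex `1` would make it equal to the
  -- first edge of the path.
  ... | yes (0 , _ , refl) = contradiction refl (joins-≢ j)
  ... | yes (1 , _ , refl) = contradiction (joins-unique j (Path.joins P (s≤s z≤n))) e≢
  ... | yes (suc (suc k) , s≤s k≤ , refl) = inj₁ (close P k k≤ e∈X (swap j))

  -- Repeated extension must meet a cycle, since a path has distinct vertices and there are only
  -- `n`. The fuel `d` bounds the extensions still possible.
  even⇒cycle : ∀ {X} → Even X → Nonempty X → ∃[ c ] edgeSet c ⊆ X
  even⇒cycle {X} even (e , e∈X) = go n (m≤m+n n 0) (edge-path e∈X)
    where
    go : ∀ {l} d → n ≤ d + l → Path X (suc l) → ∃[ c ] edgeSet c ⊆ X
    go {l} zero n≤ P = contradiction (path-bound P) (≤⇒≯ (≤-trans n≤ (m≤n+m l 1)))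
    go {l} (suc d) n≤ P with extend even P
    ... | inj₁ found = found
    ... | inj₂ P′ = go d (subst (n ≤_) (sym (+-suc d l)) n≤) P′

  edgeSet-circuit : ∀ c → GraphCircuit G (edgeSet c)
  edgeSet-circuit c = c , edgeSet-correct c

  circuit-minimal-even : ∀ c → Minimal Even (edgeSet c)
  circuit-minimal-even c = edgeSet-even c , edgeSet-nonempty c ,
    λ B even ne B⊆ → edgeSet-minimal c B⊆ ne even

  even-decomposition : ∀ X → Even X → IsDisjointUnionOfCircuits (GraphCircuit G) X
  even-decomposition = decompose (GraphCircuit G) Even remove
    where
    remove : ∀ X → Even X → Nonempty X →
      ∃[ C ] (GraphCircuit G C × Nonempty C × C ⊆ X × Even (X ⊕ C))
    remove X even ne with even⇒cycle even ne
    ... | c , c⊆X = edgeSet c , edgeSet-circuit c , edgeSet-nonempty c , c⊆X ,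
      even-⊕ X (edgeSet c) even (edgeSet-even c)

  -- Deciding whether a vertex set lies on a cycle

  Covered : (Fin n → Bool) → Set
  Covered T = ∃[ c ] (∀ v → T v ≡ true → OnCycle G c v)

  module _ (T : Fin n → Bool) where

    IncidentTo : Subset m → Fin n → Set
    IncidentTo A v = ∃[ e ] (e ∈ A × inc e v ≡ true)

    -- Reformulates `Covered` over subsets of edges, where search is finite: the cycle edge sets are
    -- exactly the minimal nonempty even sets.
    CircuitThrough : Subset m → Set
    CircuitThrough A = Minimal Even A × (∀ v → T v ≡ true → IncidentTo A v)

    incidentTo? : ∀ A v → Dec (IncidentTo A v)
    incidentTo? A v = any? λ e → (e ∈? A) ×-dec (inc e v Bool.≟ true)

    circuitThrough? : ∀ A → Dec (CircuitThrough A)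
    circuitThrough? A = minimal? Even even? A ×-dec
      all? λ v → (T v Bool.≟ true) →-dec incidentTo? A v

    through⇒covered : ∀ A → CircuitThrough A → Covered T
    through⇒covered A ((even , ne , min) , incident) with even⇒cycle even ne
    ... | c , c⊆A = c , λ v Tv →
      let e , e∈A , ev = incident v Tv in edge-onCycle c (subst (e ∈_) (sym c≡A) e∈A) ev
      where
      c≡A : edgeSet c ≡ A
      c≡A = min (edgeSet c) (edgeSet-even c) (edgeSet-nonempty c) c⊆A

    covered⇒through : (cov : Covered T) → CircuitThrough (edgeSet (proj₁ cov))
    covered⇒through (c , cover) = circuit-minimal-even c , incident
      where
      incident : ∀ v → T v ≡ true → IncidentTo (edgeSet c) v
      incident v Tv with cover v Tv
      ... | i , refl = Cycle.es c i , es∈edgeSet c i , joins⇒inc (Cycle.es-joins c i)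

    covered? : Dec (Covered T)
    covered? = map′ (λ (A , through) → through⇒covered A through)
      (λ cov → edgeSet (proj₁ cov) , covered⇒through cov) (anySubset? circuitThrough?)

  -- The binary matroid of an uncovered boundary

  module _ (X : Subset m) (v : Fin n) (∂Xv : ∂ X v ≡ true) (uncovered : ¬ Covered (∂ X)) where

    -- The span modulo 2 of the cycle space and `X`.
    EvenOr∂X : Subset m → Set
    EvenOr∂X A = Even A ⊎ (∀ w → ∂ A w ≡ ∂ X w)

    evenOr∂X? : ∀ A → Dec (EvenOr∂X A)
    evenOr∂X? A = even? A ⊎-dec all? λ w → ∂ A w Bool.≟ ∂ X w

    evenOr∂X-⊕ : ∀ A B → EvenOr∂X A → EvenOr∂X B → EvenOr∂X (A ⊕ B)
    evenOr∂X-⊕ A B (inj₁ a) (inj₁ b) = inj₁ (even-⊕ A B a b)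
    evenOr∂X-⊕ A B (inj₁ a) (inj₂ b) = inj₂ λ w → trans (∂-⊕ A B w) (cong₂ _xor_ (a w) (b w))
    evenOr∂X-⊕ A B (inj₂ a) (inj₁ b) = inj₂ λ w → trans (∂-⊕ A B w)
      (trans (xor-comm (∂ A w) _) (cong₂ _xor_ (b w) (a w)))
    evenOr∂X-⊕ A B (inj₂ a) (inj₂ b) = inj₁ λ w → trans (∂-⊕ A B w)
      (trans (cong₂ _xor_ (a w) (b w)) (xor-same (∂ X w)))

    circuit-stays-minimal : ∀ c → Minimal EvenOr∂X (edgeSet c)
    circuit-stays-minimal c = inj₁ (edgeSet-even c) , edgeSet-nonempty c , minimal
      where
      minimal : ∀ B → EvenOr∂X B → Nonempty B → B ⊆ edgeSet c → B ≡ edgeSet c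
      minimal B (inj₁ even) ne B⊆ = edgeSet-minimal c B⊆ ne even
      minimal B (inj₂ ∂B) ne B⊆ = contradiction
        (c , λ w ∂Xw → ∂-onCycle c {B} B⊆ (trans (∂B w) ∂Xw)) uncovered

    odd-member : ∀ Cs → All (Minimal EvenOr∂X) Cs →
      (∃[ C ] (Minimal EvenOr∂X C × ∂ C v ≡ true)) ⊎ Even (⨁ Cs)
    odd-member [] [] = inj₂ (∂-⊥)
    odd-member (C ∷ Cs) (min@(inj₂ ∂C , _) ∷ _) = inj₁ (C , min , trans (∂C v) ∂Xv)
    odd-member (C ∷ Cs) ((inj₁ even , _) ∷ mins) with odd-member Cs mins
    ... | inj₁ found = inj₁ found
    ... | inj₂ evens = inj₂ (even-⊕ C (⨁ Cs) even evens)

    -- Decompose `X` itself into minimal members. Were all of them even, `X` would be even, against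
    -- `∂Xv`.
    new-circuit : ∃[ C ] (Minimal EvenOr∂X C × ∂ C v ≡ true)
    new-circuit with minimal-decomposition EvenOr∂X evenOr∂X? evenOr∂X-⊕ X (inj₂ λ _ → refl)
    ... | Cs , mins , ds , eq with odd-member Cs mins
    ... | inj₁ found = found
    ... | inj₂ even = contradiction
      (trans (sym ∂Xv) (trans (cong (λ A → ∂ A v) (trans (sym eq) (⋃≡⨁ ds))) (even v))) λ ()

    uncovered⇒injection : HasNontrivialBinaryCircuitInjection G
    -- The bijection is the identity, so `image` merely rebuilds a subset from its lookups and
    -- `tabulate∘lookup` removes it.
    uncovered⇒injection = m , Minimal EvenOr∂X , ↔-refl
      , minimal-isMatroid EvenOr∂X evenOr∂X? evenOr∂X-⊕
      , minimal-isBinary EvenOr∂X evenOr∂X? evenOr∂X-⊕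
      , (λ A (c , corr) → subst (Minimal EvenOr∂X)
          (trans (sym (edgeSet-unique c corr)) (sym (tabulate∘lookup A))) (circuit-stays-minimal c))
      , proj₁ new-circuit , proj₁ (proj₂ new-circuit)
      -- The new circuit has odd degree at `v`, whereas every cycle has even degree there.
      , λ A (c , corr) eq → contradiction
          (trans (sym (proj₂ (proj₂ new-circuit)))
            (trans (cong (λ B → ∂ B v) (trans (sym eq) (trans (tabulate∘lookup A) (edgeSet-unique c corr))))
              (edgeSet-even c v))) λ ()

  -- Obstructions to a new circuit

  module _ {k} {𝒞 : Subset k → Set} (f : Fin m ↔ Fin k) (matroid : IsMatroid 𝒞) (binary : IsBinary 𝒞)
           (inj : IsCircuitInjection (GraphCircuit G) 𝒞 f)
           (B : Subset k) (cB : 𝒞 B) (new : ∀ A → GraphCircuit G A → image f A ≢ B) where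
    open IsMatroid matroid

    private
      X : Subset m
      X = preimage f B

    image-circuit : ∀ c → 𝒞 (image f (edgeSet c))
    image-circuit c = inj _ (edgeSet-circuit c)

    image-circuits : ∀ {Cs} → All (GraphCircuit G) Cs → All 𝒞 (map (image f) Cs)
    image-circuits [] = []
    image-circuits {C ∷ _} (cC ∷ cCs) = inj C cC ∷ image-circuits cCs

    -- Write `X ⊕ Y` as a sum of cycles. Then `image f Y` is the sum of `B` and their images, hence
    -- a disjoint union of circuits by binarity; as `Y` is nonempty, at least one occurs.
    circuit-below : ∀ Y → Even (X ⊕ Y) → Nonempty Y → ∃[ D ] (𝒞 D × D ⊆ image f Y)
    circuit-below Y even (e , e∈Y) =
      let Cs , cCs , dCs , ⋃Cs≡ = even-decomposition (X ⊕ Y) even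
          Ds , cDs , _ , ⋃Ds≡ = ⨁-circuits-disjoint {𝒞 = 𝒞} binary (B ∷ map (image f) Cs) (cB ∷ image-circuits cCs)
      in pick Ds cDs (trans ⋃Ds≡ (sum≡ Cs (trans (sym (⋃≡⨁ dCs)) ⋃Cs≡)))
      where
      sum≡ : ∀ Cs → ⨁ Cs ≡ X ⊕ Y → B ⊕ ⨁ (map (image f) Cs) ≡ image f Y
      sum≡ Cs ⨁Cs≡ = begin
        B ⊕ ⨁ (map (image f) Cs)       ≡⟨ cong₂ _⊕_ (sym (image-preimage f B)) (⨁-image f Cs) ⟩
        image f X ⊕ image f (⨁ Cs)     ≡⟨ cong (λ A → image f X ⊕ image f A) ⨁Cs≡ ⟩
        image f X ⊕ image f (X ⊕ Y)    ≡⟨ image-⊕ f X (X ⊕ Y) ⟨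
        image f (X ⊕ (X ⊕ Y))          ≡⟨ cong (image f) (⊕-cancelˡ X Y) ⟩
        image f Y                      ∎
        where open ≡-Reasoning
      pick : ∀ Ds → All 𝒞 Ds → ⋃ Ds ≡ image f Y → ∃[ D ] (𝒞 D × D ⊆ image f Y)
      pick [] _ eq = contradiction (subst (Inverse.to f e ∈_) (sym eq) (∈-image⁺ f {A = Y} e∈Y)) ∉⊥
      pick (D ∷ Ds) (cD ∷ _) eq = D , cD , λ {x} x∈ → subst (x ∈_) eq (All.head (members-⊆-⋃ (D ∷ Ds)) x∈)

    X-nonempty : Nonempty X
    X-nonempty = let y , y∈B = nonempty B cB in Inverse.from f y ,
      ∈-image⁻ f (subst₂ _∈_ (sym (Inverse.strictlyInverseˡ f y)) (sym (image-preimage f B)) y∈B)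

    -- The image of such a cycle would be a circuit inside `B`, hence `B` itself by incomparability,
    -- although `B` is new.
    no-cycle-inside : ∀ c → ¬ edgeSet c ⊆ X
    no-cycle-inside c c⊆X = new (edgeSet c) (edgeSet-circuit c)
      (incomparable (image f (edgeSet c)) B (image-circuit c) cB
        (subst (image f (edgeSet c) ⊆_) (image-preimage f B) (image-mono f {A = edgeSet c} {B = X} c⊆X)))

    -- A circuit below `image f Y` lies in the image of `c`, so it equals that image and `Y` is all
    -- of `edgeSet c`; but then `∂ Y` vanishes.
    no-join-inside : ∀ c Y v → Y ⊆ edgeSet c → (∀ w → ∂ Y w ≡ ∂ X w) → ¬ ∂ Y v ≡ true
    no-join-inside c Y v Y⊆c ∂Y ∂Yv =
      let D , cD , D⊆Y = circuit-below Y X⊕Y-even Y-nonempty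
          D≡c = incomparable D (image f (edgeSet c)) cD (image-circuit c)
            (⊆-trans D⊆Y (image-mono f {A = Y} {B = edgeSet c} Y⊆c))
          Y≡c = ⊆-antisym Y⊆c λ {e} e∈c →
            ∈-image⁻ f {A = Y} (D⊆Y (subst (Inverse.to f e ∈_) (sym D≡c) (∈-image⁺ f {A = edgeSet c} e∈c)))
      in contradiction (trans (sym ∂Yv) (trans (cong (λ A → ∂ A v) Y≡c) (edgeSet-even c v))) λ ()
      where
      Y-nonempty : Nonempty Y
      Y-nonempty = let e , e∈Y , _ = ∂-true⇒∃ Y v ∂Yv in e , e∈Y
      X⊕Y-even : Even (X ⊕ Y)
      X⊕Y-even w = trans (∂-⊕ X Y w) (trans (cong (∂ X w xor_) (∂Y w)) (xor-same (∂ X w)))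

    -- Add the arcs from `vs zero` to the vertices of `∂ X`; the handshake supplies the even size
    -- needed for `vs zero` to cancel.
    join-inside : ∀ c → (∀ v → ∂ X v ≡ true → OnCycle G c v) → Spans (edgeSet c) (∂ X)
    join-inside c cover = spans-join (edgeSet c) (∂ X) (vs zero) (handshake X) λ v ∂Xv →
      let i , vsi≡v = cover v ∂Xv
      in subst (λ u → Spans (edgeSet c) (λ w → δ (vs zero) w xor δ u w)) vsi≡v (spans-arc c i)
      where open Cycle c using (vs)

    -- With empty boundary, `X` is even and nonempty and so contains a cycle; with nonempty
    -- boundary, the covering cycle contains a join. Both are excluded.
    not-all-covered : ¬ (∀ v → ∂ X v ≡ true → Covered (∂ X))
    not-all-covered covered with any? (λ v → ∂ X v Bool.≟ true)
    ... | no none =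
      let c , c⊆X = even⇒cycle {X} (λ v → ¬-not λ eq → none (v , eq)) X-nonempty in no-cycle-inside c c⊆X
    ... | yes (v , ∂Xv) =
      let c , cover = covered v ∂Xv
          Y , Y⊆c , ∂Y = join-inside c cover
      in no-join-inside c Y v Y⊆c ∂Y (trans (∂Y v) ∂Xv)

  covered⇒no-injection : (∀ X v → ∂ X v ≡ true → Covered (∂ X)) →
    ¬ HasNontrivialBinaryCircuitInjection G
  covered⇒no-injection covered (_ , _ , f , matroid , binary , inj , B , cB , new) =
    not-all-covered f matroid binary inj B cB new (covered (preimage f B))

  -- Connectedness and vertex sets of even size

  module _ (no-isolated : NoIsolatedVertices G)
           (covered : ∀ X v → ∂ X v ≡ true → Covered (∂ X)) where

    edge-at : ∀ v → ∃[ e ] ∃[ w ] J e v w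
    edge-at v with no-isolated v
    ... | e , inj₁ eq = e , tgt e , inj₁ (eq , refl)
    ... | e , inj₂ eq = e , src e , inj₂ (refl , eq)

    -- If no edge joins u and v, then both lie in the boundary of an edge at u plus an edge at v,
    -- hence on a common cycle.
    connected : ∀ u v → Spans ⊤ (λ w → δ u w xor δ v w)
    connected u v with u ≟ v
    ... | yes refl = spans-resp (λ w → sym (xor-same (δ u w))) spans-zero
    ... | no u≢v = by-cases (inc fᵥ u Bool.≟ true) (inc eᵤ v Bool.≟ true)
      where
      eᵤ fᵥ : Fin m
      eᵤ = proj₁ (edge-at u)
      fᵥ = proj₁ (edge-at v)
      eu : J eᵤ u _
      eu = proj₂ (proj₂ (edge-at u))
      fv : J fᵥ v _
      fv = proj₂ (proj₂ (edge-at v))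
      ∂ef : ∀ w → ∂ (⁅ eᵤ ⁆ ⊕ ⁅ fᵥ ⁆) w ≡ inc eᵤ w xor inc fᵥ w
      ∂ef w = trans (∂-⊕ ⁅ eᵤ ⁆ ⁅ fᵥ ⁆ w) (cong₂ _xor_ (∂-⁅⁆ eᵤ w) (∂-⁅⁆ fᵥ w))
      by-cases : Dec (inc fᵥ u ≡ true) → Dec (inc eᵤ v ≡ true) → Spans ⊤ (λ w → δ u w xor δ v w)
      by-cases (yes fu) _ with inc⇒end fv fu
      ... | inj₁ v≡u = contradiction (sym v≡u) u≢v
      ... | inj₂ v′≡u = spans-edge ∈⊤ (swap (subst (J fᵥ v) v′≡u fv))
      by-cases (no _) (yes ev) with inc⇒end eu ev
      ... | inj₁ u≡v = contradiction u≡v u≢v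
      ... | inj₂ u′≡v = spans-edge ∈⊤ (subst (J eᵤ u) u′≡v eu)
      by-cases (no ¬fu) (no ¬ev) = along (covered (⁅ eᵤ ⁆ ⊕ ⁅ fᵥ ⁆) u u∈∂)
        where
        u∈∂ : ∂ (⁅ eᵤ ⁆ ⊕ ⁅ fᵥ ⁆) u ≡ true
        u∈∂ = trans (∂ef u) (cong₂ _xor_ (joins⇒inc eu) (¬-not ¬fu))
        v∈∂ : ∂ (⁅ eᵤ ⁆ ⊕ ⁅ fᵥ ⁆) v ≡ true
        v∈∂ = trans (∂ef v) (cong₂ _xor_ (¬-not ¬ev) (joins⇒inc fv))
        along : Covered (∂ (⁅ eᵤ ⁆ ⊕ ⁅ fᵥ ⁆)) → Spans ⊤ (λ w → δ u w xor δ v w)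
        along (c , cover) with cover u u∈∂ | cover v v∈∂
        -- The arcs from `vs zero` to `u` and to `v` add up to a join of `u` and `v`.
        ... | i , refl | j , refl = spans-mono (λ _ → ∈⊤) (spans-resp
          (λ w → trans (cong (_xor _) (xor-comm (δ (vs zero) w) _)) (xor-trans (δ (vs i) w) (δ (vs zero) w) (δ (vs j) w)))
          (spans-⊕ (spans-arc c i) (spans-arc c j)))
          where open Cycle c using (vs)

    -- Connectedness makes every vertex set of even size a boundary, to which the covering
    -- hypothesis applies.
    even⇒covered : ∀ T v → T v ≡ true → 𝔽₂.sum T ≡ false → Covered T
    even⇒covered T v Tv even with spans-join ⊤ T v even (λ w _ → connected v w)
    ... | Y , _ , ∂Y with covered Y v (trans (∂Y v) Tv)
    ... | c , cover = c , λ w Tw → cover w (trans (∂Y w) Tw)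

  -- An uncovered boundary would produce an injection; decidability of covering removes the double
  -- negation.
  boundaries-covered : ¬ HasNontrivialBinaryCircuitInjection G →
    ∀ X v → ∂ X v ≡ true → Covered (∂ X)
  boundaries-covered none X v ∂Xv = decidable-stable (covered? (∂ X))
    λ uncovered → none (uncovered⇒injection X v ∂Xv uncovered)

-- Parity of the number of vertices

theorem2p2 : ∀ {n m} (G : Graph n m) → 1 ≤ n → NoIsolatedVertices G →
    (2 ∣ n → ((¬ HasNontrivialBinaryCircuitInjection G) ⇔ Hamiltonian G)) ×
    (¬ (2 ∣ n) → ((¬ HasNontrivialBinaryCircuitInjection G) ⇔ AlmostHamiltonian G))
theorem2p2 {suc n} {m} G _ no-isolated = even-order , odd-order
  where
  open Graph G

  boundary-covered : ¬ HasNontrivialBinaryCircuitInjection G → ∀ T v → T v ≡ true → 𝔽₂.sum T ≡ false → Covered G T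
  boundary-covered none = even⇒covered G no-isolated (boundaries-covered G none)

  even-order : 2 ∣ suc n → ((¬ HasNontrivialBinaryCircuitInjection G) ⇔ Hamiltonian G)
  even-order 2∣n = mk⇔
    -- The full vertex set has even size, so a cycle covers it.
    (λ none → spanning (boundary-covered none (λ _ → true) zero refl (trans (sum-true (suc n)) (2∣⇒odd≡false 2∣n))))
    (λ (c , cover) → covered⇒no-injection G λ _ _ _ → c , λ v _ → cover v)
    where
    spanning : Covered G (λ _ → true) → Hamiltonian G
    spanning (c , cover) = c , λ v → cover v refl

  odd-order : ¬ (2 ∣ suc n) → ((¬ HasNontrivialBinaryCircuitInjection G) ⇔ AlmostHamiltonian G)
  odd-order ¬2∣n = mk⇔ almostHamiltonian λ almost → covered⇒no-injection G (covered almost)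
    where
    odd-n : odd (suc n) ≡ true
    odd-n = ¬2∣⇒odd≡true (suc n) ¬2∣n

    -- On a single vertex, the edge that prevents isolation would be a loop. This makes a set of
    -- size `n` nonempty below.
    n≢0 : n ≢ 0
    n≢0 refl with no-isolated zero
    ... | e , _ = loopless e (unique (src e) (tgt e))
      where
      unique : (u v : Fin 1) → u ≡ v
      unique zero zero = refl

    containing : ∀ S → Covered G (lookup S) → ∃[ c ] (∀ v → v ∈ S → OnCycle G c v)
    containing S (c , cover) = c , λ v v∈S → cover v ([]=⇒lookup v∈S)

    almostHamiltonian : ¬ HasNontrivialBinaryCircuitInjection G → AlmostHamiltonian G
    almostHamiltonian none S ∣S∣≡n with nonempty? S
    ... | no empty = contradiction
      (trans (sym ∣S∣≡n) (trans (cong ∣_∣ (Empty-unique empty)) (∣⊥∣≡0 (suc n)))) n≢0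
    -- `S` has size `n`, which is even because `suc n` is odd.
    ... | yes (v , v∈S) = containing S (boundary-covered none (lookup S) v ([]=⇒lookup v∈S)
      (trans (sum-lookup S) (trans (cong odd ∣S∣≡n) (trans (sym (not-involutive (odd n))) (cong not odd-n)))))

    -- A boundary has even size and the order is odd, so some vertex `v` is missing from it; a cycle
    -- through all other vertices covers the boundary.
    covered : AlmostHamiltonian G → ∀ X v → ∂ G X v ≡ true → Covered G (∂ G X)
    covered almost X _ _ with any? (λ v → ∂ G X v Bool.≟ false)
    ... | no none = contradiction
      (trans (sym odd-n) (trans (sym (sum-true (suc n)))
        (trans (𝔽₂.sum-cong-≗ λ v → sym (¬-not λ eq → none (v , eq))) (handshake G X)))) λ ()
    ... | yes (v , ∂Xv) =
      let c , cover = almost (∁ ⁅ v ⁆) (trans (∣∁p∣≡n∸∣p∣ ⁅ v ⁆) (cong (suc n ∸_) (∣⁅x⁆∣≡1 v)))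
      in c , λ w ∂Xw → cover w (x∉p⇒x∈∁p λ w∈ →
        contradiction (trans (sym ∂Xw) (trans (cong (∂ G X) (x∈⁅y⁆⇒x≡y v w∈)) ∂Xv)) λ ())
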